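{- Let $m\ge 2$ and let $h_\omega$ be the infinite $m$-bonacci word. (1) Every prefix of type-1 of $h_\omega$ is closed. (2) Every prefix of type-2 of $h_\omega$ is open.
   Context: Fix $m\ge 2$ and $A_m=\{0,1,\ldots,m-1\}$. The morphism $\varphi_m:A_m^*\to A_m^*$ is given by $\varphi_m(i)=0(i+1)$ for $0\le i\le m-2$ and $\varphi_m(m-1)=0$. Put $h_n=\varphi_m^n(0)$ for $n\ge 0$; the infinite $m$-bonacci word $h_\omega$ is the fixed point of $\varphi_m$ starting with $0$. $w^R$ is the reversal of a word $w$ and $|w|$ its length. $(u_n)_{n\ge 1}$ is the sequence of palindromic prefixes of $h_\omega$ sorted by increasing length, starting with the empty word $u_1=\varepsilon$ (so $u_2=0$). The words $t_n$: $t_1=\varepsilon$; $t_n=(n-1)\,h_0^Rh_1^R\cdots h_{n-3}^R$ for $2\le n\le m$ (here $n-1$ denotes a letter, and the product is empty for $n=2$); $t_n=h_{n-m-1}^Rh_{n-m}^R\cdots h_{n-3}^R$ for $n\ge m+1$. For a nonempty finite prefix $w$ of $h_\omega$, let $n(w)$ be the unique positive integer with $|u_{n(w)}|<|w|\le |u_{n(w)+1}|$. The prefix $w$ is of type-1 if $|u_{n(w)}|+|t_{n(w)}|<|w|\le|u_{n(w)+1}|$, and of type-2 if $|u_{n(w)}|<|w|\le|u_{n(w)}|+|t_{n(w)}|$. A word $x$ is a border of $w$ if it is nonempty and both a prefix and a suffix of $w$. A nonempty finite word $w$ is closed if it is a single letter or it has a border $x$ that occurs exactly twice in $w$ (occurrences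 may overlap); otherwise it is open. -}

module Defs where

open import Data.Empty using (⊥-elim)
open import Data.Fin.Base using (Fin; toℕ; fromℕ<)
import Data.Fin.Properties as Fin
open import Data.List.Base
  using (List; []; _∷_; _∷ʳ_; _++_; [_]; length; reverse; concatMap; applyUpTo; upTo; filter; tails)
import Data.List.Properties as List
open import Data.List.Relation.Binary.Prefix.Heterogeneous using (Prefix; []; _∷_)
import Data.List.Relation.Binary.Prefix.Heterogeneous.Properties as Prefix
open import Data.List.Relation.Binary.Suffix.Heterogeneous using (Suffix)
open import Data.Nat.Base
open import Data.Nat.Properties
open import Data.Product.Base using (∃; ∃-syntax; _×_; _,_; proj₁; proj₂)
open import Data.Sum.Base using (_⊎_; inj₁; inj₂)
open import Relation.Binary.PropositionalEquality
  using (_≡_; _≢_; refl; sym; trans; cong; cong₂; subst; subst₂; module ≡-Reasoning)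
open import Relation.Nullary using (¬_; Dec; yes; no)

module Bonacci (m : ℕ) (2≤m : 2 ≤ m) where

  Letter : Set
  Letter = Fin m

  Word : Set
  Word = List Letter

  InfiniteWord : Set
  InfiniteWord = ℕ → Letter

  𝟎 : Letter
  𝟎 = fromℕ< (≤-trans (s≤s z≤n) 2≤m)

  φ : Letter → Word
  φ i with suc (toℕ i) <? m
  ... | yes i+1<m = 𝟎 ∷ fromℕ< i+1<m ∷ []
  ... | no  _     = 𝟎 ∷ []

  φ* : Word → Word
  φ* = concatMap φ

  h : ℕ → Word
  h zero    = [ 𝟎 ]
  h (suc n) = φ* (h n)

  infix 4 _≺_
  _≺_ : Word → InfiniteWord → Set
  w ≺ x = w ≡ applyUpTo x (length w)

  -- φ is non-erasing, so φ(x) is the unique infinite word having the images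
  -- of all finite prefixes of x as prefixes; hence φ(x) = x amounts to `fixed`.
  record Is-hω (x : InfiniteWord) : Set where
    field
      start : x 0 ≡ 𝟎
      fixed : ∀ n → φ* (applyUpTo x n) ≺ x

  Palindrome : Word → Set
  Palindrome w = reverse w ≡ w

  PalindromicPrefix : InfiniteWord → Word → Set
  PalindromicPrefix x w = w ≺ x × Palindrome w

  -- The sequence is indexed from 1; the value u 0 is irrelevant.
  record IsPalindromicPrefixSequence (x : InfiniteWord) (u : ℕ → Word) : Set where
    field
      first      : u 1 ≡ []
      sound      : ∀ n → 1 ≤ n → PalindromicPrefix x (u n)
      increasing : ∀ n → 1 ≤ n → length (u n) < length (u (suc n))
      complete   : ∀ w → PalindromicPrefix x w → ∃[ n ] 1 ≤ n × u n ≡ w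

  -- hᴿ a k is the product of the k words (h_a)ᴿ (h_{a+1})ᴿ ⋯ (h_{a+k-1})ᴿ.
  hᴿ : ℕ → ℕ → Word
  hᴿ a k = concatMap (λ j → reverse (h (a + j))) (upTo k)

  -- The sequence is indexed from 1; t 0 is a dummy value.  In the last clause
  -- n = k + 2: the letter is n - 1 and the product h_0ᴿ ⋯ h_{n-3}ᴿ has k
  -- factors if n ≤ m, while h_{n-m-1}ᴿ ⋯ h_{n-3}ᴿ has m - 1 factors if n > m.
  t : ℕ → Word
  t 0             = []
  t 1             = []
  t (suc (suc k)) with suc k <? m
  ... | yes k+1<m = fromℕ< k+1<m ∷ hᴿ 0 k
  ... | no  _     = hᴿ (suc k ∸ m) (m ∸ 1)

  -- n = n(w)
  IsIndex : (ℕ → Word) → Word → ℕ → Set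
  IsIndex u w n = 1 ≤ n × length (u n) < length w × length w ≤ length (u (suc n))

  record Type-1 (x : InfiniteWord) (u : ℕ → Word) (w : Word) : Set where
    field
      nonempty : w ≢ []
      prefix   : w ≺ x
      n        : ℕ
      index    : IsIndex u w n
      lower    : length (u n) + length (t n) < length w
      upper    : length w ≤ length (u (suc n))

  record Type-2 (x : InfiniteWord) (u : ℕ → Word) (w : Word) : Set where
    field
      nonempty : w ≢ []
      prefix   : w ≺ x
      n        : ℕ
      index    : IsIndex u w n
      lower    : length (u n) < length w
      upper    : length w ≤ length (u n) + length (t n)

  -- For nonempty v, the number of suffixes of w starting with v.
  occurrences : Word → Word → ℕ
  occurrences v w = length (filter (Prefix.prefix? Fin._≟_ v) (tails w))

  Border : Word → Word → Set
  Border v w = v ≢ [] × Prefix _≡_ v w × Suffix _≡_ v w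

  Closed : Word → Set
  Closed w = w ≢ [] × (length w ≡ 1 ⊎ ∃[ v ] Border v w × occurrences v w ≡ 2)

  Open : Word → Set
  Open w = w ≢ [] × ¬ Closed w

  -- The notions characterised above are inhabited: Is-hω has exactly one
  -- element, every such word has a sequence of palindromic prefixes, and n(w)
  -- exists and is unique.

  private
    at : Word → ℕ → Letter
    at []      _       = 𝟎
    at (a ∷ w) zero    = a
    at (a ∷ w) (suc n) = at w n

    at-≼ : ∀ {v w} → Prefix _≡_ v w → ∀ {k} → k < length v → at v k ≡ at w k
    at-≼ (refl ∷ p) {zero}  _         = refl
    at-≼ (refl ∷ p) {suc k} (s≤s k<n) = at-≼ p k<n

    at⇒≺ : ∀ w x → (∀ {k} → k < length w → at w k ≡ x k) → w ≺ x
    at⇒≺ []      x eq = refl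
    at⇒≺ (a ∷ w) x eq = cong₂ _∷_ (eq (s≤s z≤n)) (at⇒≺ w _ (λ k<n → eq (s≤s k<n)))

    at-applyUpTo : ∀ x n {k} → k < n → at (applyUpTo x n) k ≡ x k
    at-applyUpTo x (suc n) {zero}  _         = refl
    at-applyUpTo x (suc n) {suc k} (s≤s k<n) = at-applyUpTo _ n k<n

    ≺⇒at : ∀ {w x} → w ≺ x → ∀ {k} → k < length w → at w k ≡ x k
    ≺⇒at {w} {x} w≺x {k} k<n = trans (cong (λ v → at v k) w≺x) (at-applyUpTo x (length w) k<n)

    ≼-≺ : ∀ {v w x} → Prefix _≡_ v w → w ≺ x → v ≺ x
    ≼-≺ {v} {w} p w≺x = at⇒≺ v _
      (λ k<n → trans (at-≼ p k<n) (≺⇒at {w} w≺x (≤-trans k<n (Prefix.length-mono p))))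

    ≼-++ : ∀ (v w : Word) → Prefix _≡_ v (v ++ w)
    ≼-++ []      w = []
    ≼-++ (a ∷ v) w = refl ∷ ≼-++ v w

    ++-≼ : ∀ u {v w : Word} → Prefix _≡_ v w → Prefix _≡_ (u ++ v) (u ++ w)
    ++-≼ []      p = p
    ++-≼ (a ∷ u) p = refl ∷ ++-≼ u p

    applyUpTo-≼ : ∀ (x : InfiniteWord) {i j} → i ≤ j → Prefix _≡_ (applyUpTo x i) (applyUpTo x j)
    applyUpTo-≼ x z≤n     = []
    applyUpTo-≼ x (s≤s p) = refl ∷ applyUpTo-≼ _ p

    φ*-≼ : ∀ {v w} → Prefix _≡_ v w → Prefix _≡_ (φ* v) (φ* w)
    φ*-≼ []                  = []
    φ*-≼ (_∷_ {a} refl p) = ++-≼ (φ a) (φ*-≼ p)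

    1≤∣φ∣ : ∀ a → 1 ≤ length (φ a)
    1≤∣φ∣ a with suc (toℕ a) <? m
    ... | yes _ = s≤s z≤n
    ... | no  _ = s≤s z≤n

    ∣φ𝟎∣ : length (φ 𝟎) ≡ 2
    ∣φ𝟎∣ with suc (toℕ 𝟎) <? m
    ... | yes _ = refl
    ... | no ¬p = ⊥-elim (¬p (subst (λ k → suc k < m) (sym (Fin.toℕ-fromℕ< _)) 2≤m))

    ∣φ*∣ : ∀ w → length w ≤ length (φ* w)
    ∣φ*∣ []      = z≤n
    ∣φ*∣ (a ∷ w) = subst (suc (length w) ≤_) (sym (List.length-++ (φ a)))
      (+-mono-≤ (1≤∣φ∣ a) (∣φ*∣ w))

    ∣φ*𝟎∷∣ : ∀ w → length (𝟎 ∷ w) < length (φ* (𝟎 ∷ w))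
    ∣φ*𝟎∷∣ w = subst (2 + length w ≤_) (sym (List.length-++ (φ 𝟎)))
      (subst (λ k → 2 + length w ≤ k + length (φ* w)) (sym ∣φ𝟎∣) (+-monoʳ-≤ 2 (∣φ*∣ w)))

    φ-𝟎∷ : ∀ a → ∃[ v ] φ a ≡ 𝟎 ∷ v
    φ-𝟎∷ a with suc (toℕ a) <? m
    ... | yes _ = _ , refl
    ... | no  _ = _ , refl

    φ*-∷ : ∀ a w → ∃[ v ] φ* (a ∷ w) ≡ 𝟎 ∷ v
    φ*-∷ a w = _ , cong (_++ φ* w) (proj₂ (φ-𝟎∷ a))

    grow : ∀ {w} → ∃ (λ v → w ≡ 𝟎 ∷ v) → length w < length (φ* w)
    grow (v , refl) = ∣φ*𝟎∷∣ v

    h-𝟎∷ : ∀ n → ∃[ v ] h n ≡ 𝟎 ∷ v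
    h-𝟎∷ zero = [] , refl
    h-𝟎∷ (suc n) with h n | h-𝟎∷ n
    ... | _ | v , refl = φ*-∷ 𝟎 v

    ∣h∣ : ∀ n → n < length (h n)
    ∣h∣ zero    = s≤s z≤n
    ∣h∣ (suc n) = ≤-trans (s≤s (∣h∣ n)) (grow (h-𝟎∷ n))

    h-step : ∀ n → Prefix _≡_ (h n) (h (suc n))
    h-step zero    = subst (Prefix _≡_ [ 𝟎 ]) (sym (proj₂ (φ*-∷ 𝟎 []))) (refl ∷ [])
    h-step (suc n) = φ*-≼ (h-step n)

    h-mono′ : ∀ {i j} → i ≤′ j → Prefix _≡_ (h i) (h j)
    h-mono′ ≤′-refl             = subst (Prefix _≡_ _) (List.++-identityʳ _) (≼-++ _ [])
    h-mono′ (≤′-step {n} i≤j) = Prefix.trans trans (h-mono′ i≤j) (h-step n)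

    h-mono : ∀ {i j} → i ≤ j → Prefix _≡_ (h i) (h j)
    h-mono i≤j = h-mono′ (≤⇒≤′ i≤j)

  limit-hω : InfiniteWord
  limit-hω n = at (h n) n

  private
    h≺hω : ∀ n → h n ≺ limit-hω
    h≺hω n = at⇒≺ (h n) limit-hω eq
      where
      eq : ∀ {k} → k < length (h n) → at (h n) k ≡ at (h k) k
      eq {k} k<∣hn∣ with ≤-total k n
      ... | inj₁ k≤n = sym (at-≼ (h-mono k≤n) (∣h∣ k))
      ... | inj₂ n≤k = at-≼ (h-mono n≤k) k<∣hn∣

    ≺⇒≼ : ∀ {x n w} → w ≺ x → n ≤ length w → Prefix _≡_ (applyUpTo x n) w
    ≺⇒≼ w≺x n≤ = subst (Prefix _≡_ _) (sym w≺x) (applyUpTo-≼ _ n≤)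

  limit-hω-is-hω : Is-hω limit-hω
  limit-hω-is-hω = record
    { start = refl
    ; fixed = λ n → ≼-≺ (φ*-≼ (≺⇒≼ (h≺hω n) (<⇒≤ (∣h∣ n)))) (h≺hω (suc n))
    }

  hω-unique : ∀ x → Is-hω x → ∀ k → x k ≡ limit-hω k
  hω-unique x isx k = sym (≺⇒at (h≺x k) (∣h∣ k))
    where
    open Is-hω isx
    h≺x : ∀ n → h n ≺ x
    h≺x zero    = cong [_] (sym start)
    h≺x (suc n) = subst (λ w → φ* w ≺ x) (sym (h≺x n)) (fixed (length (h n)))

  private
    -- If w is a palindrome, so is φ(w)0.
    snoc-φ : ∀ a → reverse (φ a ∷ʳ 𝟎) ≡ φ a ∷ʳ 𝟎
    snoc-φ a with suc (toℕ a) <? m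
    ... | yes _ = refl
    ... | no  _ = refl

    φ*-∷ʳ : ∀ w a → φ* (w ∷ʳ a) ≡ φ* w ++ φ a
    φ*-∷ʳ w a = trans (List.concatMap-++ φ w [ a ]) (cong (φ* w ++_) (List.++-identityʳ (φ a)))

    -- 0 φ(w)ᴿ = φ(wᴿ) 0
    𝟎∷-reverse-φ* : ∀ w → 𝟎 ∷ reverse (φ* w) ≡ φ* (reverse w) ∷ʳ 𝟎
    𝟎∷-reverse-φ* []      = refl
    𝟎∷-reverse-φ* (a ∷ w) = begin
      𝟎 ∷ reverse (φ a ++ φ* w)              ≡⟨ cong (𝟎 ∷_) (List.reverse-++ (φ a) (φ* w)) ⟩
      (𝟎 ∷ reverse (φ* w)) ++ reverse (φ a)  ≡⟨ cong (_++ reverse (φ a)) (𝟎∷-reverse-φ* w) ⟩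
      (φ* (reverse w) ∷ʳ 𝟎) ++ reverse (φ a) ≡⟨ List.++-assoc (φ* (reverse w)) _ _ ⟩
      φ* (reverse w) ++ 𝟎 ∷ reverse (φ a)    ≡⟨ cong (φ* (reverse w) ++_) (List.reverse-++ (φ a) [ 𝟎 ]) ⟨
      φ* (reverse w) ++ reverse (φ a ∷ʳ 𝟎)   ≡⟨ cong (φ* (reverse w) ++_) (snoc-φ a) ⟩
      φ* (reverse w) ++ (φ a ∷ʳ 𝟎)           ≡⟨ List.++-assoc (φ* (reverse w)) _ _ ⟨
      (φ* (reverse w) ++ φ a) ∷ʳ 𝟎           ≡⟨ cong (_∷ʳ 𝟎) (φ*-∷ʳ (reverse w) a) ⟨
      φ* (reverse w ∷ʳ a) ∷ʳ 𝟎               ≡⟨ cong (λ v → φ* v ∷ʳ 𝟎) (List.unfold-reverse a w) ⟨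
      φ* (reverse (a ∷ w)) ∷ʳ 𝟎              ∎
      where open ≡-Reasoning

    pal-φ* : ∀ w → Palindrome w → Palindrome (φ* w ∷ʳ 𝟎)
    pal-φ* w pal = trans (List.reverse-++ (φ* w) [ 𝟎 ])
      (trans (𝟎∷-reverse-φ* w) (cong (λ v → φ* v ∷ʳ 𝟎) pal))

    least : ∀ {P : ℕ → Set} → (∀ k → Dec (P k)) → ∀ n → P n →
            ∃[ k ] P k × (∀ {j} → P j → k ≤ j)
    least P? zero    p = 0 , p , λ _ → z≤n
    least P? (suc n) p with P? 0
    ... | yes p₀ = 0 , p₀ , λ _ → z≤n
    ... | no ¬p₀ with least (λ k → P? (suc k)) n p
    ...   | k , q , k≤ = suc k , q , λ { {zero} p₀ → ⊥-elim (¬p₀ p₀) ; {suc j} pj → s≤s (k≤ pj) }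

  module _ (x : InfiniteWord) (isx : Is-hω x) where

    open Is-hω isx

    private
      P : ℕ → Set
      P n = Palindrome (applyUpTo x n)

      P? : ∀ n → Dec (P n)
      P? n = List.≡-dec Fin._≟_ _ _

      φ*-∷ʳ-≺ : ∀ n → φ* (applyUpTo x n) ∷ʳ 𝟎 ≺ x
      φ*-∷ʳ-≺ n with φ-𝟎∷ (x n)
      ... | v , eq = ≼-≺ (++-≼ (φ* (applyUpTo x n)) {w = 𝟎 ∷ v} (refl ∷ []))
        (subst (_≺ x)
          (trans (cong φ* (sym (List.applyUpTo-∷ʳ x n)))
            (trans (φ*-∷ʳ (applyUpTo x n) (x n)) (cong (φ* (applyUpTo x n) ++_) eq)))
          (fixed (suc n)))

      larger : ∀ n → P n → ∃[ k ] n < k × P k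
      larger n p = length w′ , n<k , subst Palindrome (φ*-∷ʳ-≺ n) (pal-φ* _ p)
        where
        w′ = φ* (applyUpTo x n) ∷ʳ 𝟎
        n<k : n < length w′
        n<k = subst (n <_) (sym (trans (List.length-++ (φ* (applyUpTo x n))) (+-comm _ 1)))
          (s≤s (subst (_≤ length (φ* (applyUpTo x n))) (List.length-applyUpTo x n) (∣φ*∣ (applyUpTo x n))))

      next : ∀ n → P n → ∃[ k ] (n < k × P k) × (∀ {j} → n < j × P j → k ≤ j)
      next n p = least dec _ (proj₂ (larger n p))
        where
        dec : ∀ k → Dec (n < k × P k)
        dec k with n <? k | P? k
        ... | yes a | yes b = yes (a , b)
        ... | no ¬a | _     = no λ ab → ¬a (proj₁ ab)
        ... | yes _ | no ¬b = no λ ab → ¬b (proj₂ ab)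

      ℓ : ℕ → ∃ P
      ℓ zero    = 0 , refl
      ℓ (suc n) with next (proj₁ (ℓ n)) (proj₂ (ℓ n))
      ... | k , (_ , p) , _ = k , p

      ∣_∣ℓ : ℕ → ℕ
      ∣ n ∣ℓ = proj₁ (ℓ n)

      ℓ-inc : ∀ n → ∣ n ∣ℓ < ∣ suc n ∣ℓ
      ℓ-inc n = proj₁ (proj₁ (proj₂ (next (proj₁ (ℓ n)) (proj₂ (ℓ n)))))

      ℓ-least : ∀ n {j} → ∣ n ∣ℓ < j → P j → ∣ suc n ∣ℓ ≤ j
      ℓ-least n lt p = proj₂ (proj₂ (next (proj₁ (ℓ n)) (proj₂ (ℓ n)))) (lt , p)

      n≤ℓ : ∀ n → n ≤ ∣ n ∣ℓ
      n≤ℓ zero    = z≤n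
      n≤ℓ (suc n) = ≤-trans (s≤s (n≤ℓ n)) (ℓ-inc n)

      ℓ-complete : ∀ n {j} → P j → j ≤ ∣ n ∣ℓ → ∃[ k ] ∣ k ∣ℓ ≡ j
      ℓ-complete zero    p j≤ = 0 , sym (n≤0⇒n≡0 j≤)
      ℓ-complete (suc n) {j} p j≤ with j ≤? ∣ n ∣ℓ
      ... | yes j≤′ = ℓ-complete n p j≤′
      ... | no  j≰  = suc n , ≤-antisym (ℓ-least n (≰⇒> j≰) p) j≤

    pals : ℕ → Word
    pals n = applyUpTo x ∣ n ∸ 1 ∣ℓ

    pals-isPalindromicPrefixSequence : IsPalindromicPrefixSequence x pals
    pals-isPalindromicPrefixSequence = record
      { first      = refl
      ; sound      = λ n _ → cong (applyUpTo x) (sym (List.length-applyUpTo x ∣ n ∸ 1 ∣ℓ)) , proj₂ (ℓ (n ∸ 1))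
      ; increasing = λ { (suc n) _ → subst₂ _<_ (sym (List.length-applyUpTo x _))
                                                (sym (List.length-applyUpTo x _)) (ℓ-inc n) }
      ; complete   = λ w (w≺x , pal) →
          let k , eq = ℓ-complete (length w) (subst Palindrome w≺x pal) (n≤ℓ (length w))
          in suc k , s≤s z≤n , trans (cong (applyUpTo x) eq) (sym w≺x)
      }

  module _ {x : InfiniteWord} {u : ℕ → Word} (isu : IsPalindromicPrefixSequence x u) where

    open IsPalindromicPrefixSequence isu

    private
      u-mono : ∀ {i j} → 1 ≤ i → i ≤′ j → length (u i) ≤ length (u j)
      u-mono 1≤i ≤′-refl             = ≤-refl
      u-mono 1≤i (≤′-step {n} i≤j) =
        ≤-trans (u-mono 1≤i i≤j) (<⇒≤ (increasing n (≤-trans 1≤i (≤′⇒≤ i≤j))))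

      n≤∣u∣ : ∀ n → n ≤ length (u (suc n))
      n≤∣u∣ zero    = z≤n
      n≤∣u∣ (suc n) = ≤-trans (s≤s (n≤∣u∣ n)) (increasing (suc n) (s≤s z≤n))

      index-≤ : ∀ {w i j} → IsIndex u w i → IsIndex u w j → i ≤ j
      index-≤ {i = i} {j} (_ , ui<w , _) (_ , _ , w≤uj) with i ≤? j
      ... | yes i≤j = i≤j
      ... | no  i≰j = ⊥-elim (<⇒≱ ui<w (≤-trans w≤uj (u-mono (s≤s z≤n) (≤⇒≤′ (≰⇒> i≰j)))))

    index-unique : ∀ {w i j} → IsIndex u w i → IsIndex u w j → i ≡ j
    index-unique {w} p q = ≤-antisym (index-≤ {w} p q) (index-≤ {w} q p)

    index-exists : ∀ w → w ≢ [] → ∃[ n ] IsIndex u w n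
    index-exists w w≢[] = go (length w) (n≤∣u∣ (length w))
      where
      0<∣_∣ : ∀ v → v ≢ [] → 0 < length v
      0<∣ []    ∣ v≢[] = ⊥-elim (v≢[] refl)
      0<∣ _ ∷ _ ∣ _    = s≤s z≤n

      go : ∀ n → length w ≤ length (u (suc n)) → ∃[ n ] IsIndex u w n
      go zero    w≤ = ⊥-elim (<⇒≱ (0<∣ w ∣ w≢[]) (subst (λ v → length w ≤ length v) first w≤))
      go (suc n) w≤ with length w ≤? length (u (suc n))
      ... | yes w≤′ = go n w≤′
      ... | no  w≰  = suc n , s≤s z≤n , ≰⇒> w≰ , w≤

{-# OPTIONS --safe #-}
module Submission where

-- Let Hₖ = |hₖ| and let Lₖ = H₀ + ⋯ + Hₖ₋₁.  The nonempty palindromic prefixes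
-- of x = h_ω are the words φ(v)0 with v a palindromic prefix, so |uₖ₊₁| = Lₖ,
-- and x has a factor of length Lₖ at position Hₖ equal to its prefix.
-- Desubstitution shows conversely that the prefix of length Lₖ + 1 does not
-- occur at any position strictly between 0 and Hₖ₊₁.
--
-- Moreover |tₖ₊₂| = Hₖ₊₁ - Hₖ, so for n(w) = k + 2 the word w is of type-1 iff
-- |w| - Hₖ₊₁ > Lₖ.  In that case the border of length |w| - Hₖ₊₁ ≤ Lₖ₊₁ occurs
-- only at 0 and Hₖ₊₁.  In type-2, a border of length at most Lₖ also occurs at
-- Hₖ, before the end of w, and a longer one would first recur at Hₖ₊₁ or later,
-- making w too long.

open import Data.Empty using (⊥-elim)
open import Data.Fin.Base using (Fin; toℕ)
import Data.Fin.Properties as Fin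
open import Data.List.Base
  using ([]; _∷_; _∷ʳ_; _++_; [_]; length; reverse; concatMap; applyUpTo; upTo; filter; tails)
import Data.List.Properties as List
open import Data.List.Relation.Binary.Pointwise using (Pointwise-≡⇒≡; ≡⇒Pointwise-≡)
open import Data.List.Relation.Binary.Prefix.Heterogeneous using (Prefix; []; _∷_)
import Data.List.Relation.Binary.Prefix.Heterogeneous.Properties as Prefix
open import Data.List.Relation.Binary.Suffix.Heterogeneous using (Suffix; here; there; _++ˢ_)
open import Data.Nat.Base
open import Data.Nat.Induction using (<-rec)
open import Data.Nat.Properties
open import Data.Nat.Tactic.RingSolver using (solve-∀)
open import Data.Product.Base using (∃-syntax; _×_; _,_; proj₁; proj₂)
open import Data.Sum.Base using (_⊎_; inj₁; inj₂)
open import Relation.Binary.Definitions using (tri<; tri≈; tri>)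
open import Relation.Binary.PropositionalEquality
  using (_≡_; _≢_; refl; sym; trans; cong; cong₂; subst; subst₂; module ≡-Reasoning)
open import Relation.Nullary using (¬_; yes; no)
open import Relation.Unary using (Pred; Decidable)
open import Defs

-- Finite words as initial segments of infinite ones.

module _ {a} {A : Set a} where

  applyUpTo-+ : ∀ (f : ℕ → A) m n →
    applyUpTo f (m + n) ≡ applyUpTo f m ++ applyUpTo (λ r → f (m + r)) n
  applyUpTo-+ f zero    n = refl
  applyUpTo-+ f (suc m) n = cong (f 0 ∷_) (applyUpTo-+ (λ r → f (suc r)) m n)

  applyUpTo-cong : ∀ {f g : ℕ → A} n → (∀ {r} → r < n → f r ≡ g r) → applyUpTo f n ≡ applyUpTo g n
  applyUpTo-cong zero    eq = refl
  applyUpTo-cong (suc n) eq = cong₂ _∷_ (eq (s≤s z≤n)) (applyUpTo-cong n (λ r<n → eq (s≤s r<n)))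

  applyUpTo-injective : ∀ {f g : ℕ → A} n → applyUpTo f n ≡ applyUpTo g n →
    ∀ {r} → r < n → f r ≡ g r
  applyUpTo-injective (suc n) eq {zero}  _         = List.∷-injectiveˡ eq
  applyUpTo-injective (suc n) eq {suc r} (s≤s r<n) = applyUpTo-injective n (List.∷-injectiveʳ eq) r<n

  prefix-applyUpTo⁺ : ∀ {f g : ℕ → A} {m n} → m ≤ n → (∀ {r} → r < m → f r ≡ g r) →
    Prefix _≡_ (applyUpTo f m) (applyUpTo g n)
  prefix-applyUpTo⁺ z≤n       eq = []
  prefix-applyUpTo⁺ (s≤s m≤n) eq = eq (s≤s z≤n) ∷ prefix-applyUpTo⁺ m≤n (λ r<m → eq (s≤s r<m))

  prefix-applyUpTo⁻ : ∀ {f g : ℕ → A} m n → Prefix _≡_ (applyUpTo f m) (applyUpTo g n) →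
    m ≤ n × (∀ {r} → r < m → f r ≡ g r)
  prefix-applyUpTo⁻ zero    n       _       = z≤n , λ ()
  prefix-applyUpTo⁻ (suc m) (suc n) (e ∷ p) with prefix-applyUpTo⁻ m n p
  ... | m≤n , eq = s≤s m≤n , λ { {zero} _ → e ; {suc r} (s≤s r<m) → eq r<m }

  prefix-of-applyUpTo : ∀ {v} {f : ℕ → A} n → Prefix _≡_ v (applyUpTo f n) → v ≡ applyUpTo f (length v)
  prefix-of-applyUpTo zero    []         = refl
  prefix-of-applyUpTo (suc n) []         = refl
  prefix-of-applyUpTo (suc n) (refl ∷ p) = cong (_ ∷_) (prefix-of-applyUpTo n p)

  suffix-applyUpTo⁺ : ∀ (f : ℕ → A) m n → Suffix _≡_ (applyUpTo (λ r → f (m + r)) n) (applyUpTo f (m + n))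
  suffix-applyUpTo⁺ f m n = subst (Suffix _≡_ _) (sym (applyUpTo-+ f m n))
    (applyUpTo f m ++ˢ here (≡⇒Pointwise-≡ refl))

  suffix-applyUpTo⁻ : ∀ (f : ℕ → A) n {v} → Suffix _≡_ v (applyUpTo f n) →
    ∃[ m ] m + length v ≡ n × v ≡ applyUpTo (λ r → f (m + r)) (length v)
  suffix-applyUpTo⁻ f zero    (here p) with refl ← Pointwise-≡⇒≡ p = 0 , refl , refl
  suffix-applyUpTo⁻ f (suc n) (here p) with refl ← Pointwise-≡⇒≡ p =
    0 , cong suc (List.length-applyUpTo _ n)
      , cong (applyUpTo f) (cong suc (sym (List.length-applyUpTo _ n)))
  suffix-applyUpTo⁻ f (suc n) (there s) with suffix-applyUpTo⁻ _ n s
  ... | m , eq , eq′ = suc m , cong suc eq , eq′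

  -- Indexes suffixes by starting position, so that `occurrences` becomes a count over positions;
  -- the extra index `n` is the empty suffix.
  tails-applyUpTo : ∀ (f : ℕ → A) n →
    tails (applyUpTo f n) ≡ applyUpTo (λ j → applyUpTo (λ r → f (j + r)) (n ∸ j)) (suc n)
  tails-applyUpTo f zero    = refl
  tails-applyUpTo f (suc n) = cong (applyUpTo f (suc n) ∷_) (tails-applyUpTo (λ r → f (suc r)) n)

-- Counting the indices that satisfy a decidable predicate.

module _ {a p} {A : Set a} {P : Pred A p} (P? : Decidable P) where

  count : (ℕ → A) → ℕ → ℕ
  count f n = length (filter P? (applyUpTo f n))

  count-accept : ∀ f n → P (f 0) → count f (suc n) ≡ suc (count (λ r → f (suc r)) n)
  count-accept f n Pf0 = cong length (List.filter-accept P? Pf0)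

  count-reject : ∀ f n → ¬ P (f 0) → count f (suc n) ≡ count (λ r → f (suc r)) n
  count-reject f n ¬Pf0 = cong length (List.filter-reject P? ¬Pf0)

  count≡0 : ∀ f n → (∀ {j} → j < n → ¬ P (f j)) → count f n ≡ 0
  count≡0 f zero    none = refl
  count≡0 f (suc n) none = trans (count-reject f n (none (s≤s z≤n)))
    (count≡0 _ n (λ j<n → none (s≤s j<n)))

  count≡1 : ∀ f n {i} → i < n → P (f i) → (∀ {j} → j < n → P (f j) → j ≡ i) → count f n ≡ 1
  count≡1 f (suc n) {zero} _ Pfi only = trans (count-accept f n Pfi)
    (cong suc (count≡0 _ n (λ j<n Pfj → 1+n≢0 (only (s≤s j<n) Pfj))))
  count≡1 f (suc n) {suc i} (s≤s i<n) Pfi only =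
    trans (count-reject f n (λ Pf0 → 0≢1+n (only (s≤s z≤n) Pf0)))
      (count≡1 _ n i<n Pfi (λ j<n Pfj → suc-injective (only (s≤s j<n) Pfj)))

  -- Index 0 is singled out because a border always occurs there.
  count≡2 : ∀ f n {i} → 0 < i → i < n → P (f 0) → P (f i) →
    (∀ {j} → 0 < j → j < n → P (f j) → j ≡ i) → count f n ≡ 2
  count≡2 f (suc n) {suc i} _ (s≤s i<n) Pf0 Pfi only = trans (count-accept f n Pf0)
    (cong suc (count≡1 _ n i<n Pfi (λ j<n Pfj → suc-injective (only (s≤s z≤n) (s≤s j<n) Pfj))))

  count-tail : ∀ f n → count (λ r → f (suc r)) n ≤ count f (suc n)
  count-tail f n with P? (f 0)
  ... | yes _ = n≤1+n _
  ... | no  _ = ≤-refl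

  1≤count : ∀ f n {i} → i < n → P (f i) → 1 ≤ count f n
  1≤count f (suc n) {zero}  _         Pfi = subst (1 ≤_) (sym (count-accept f n Pfi)) (s≤s z≤n)
  1≤count f (suc n) {suc i} (s≤s i<n) Pfi = ≤-trans (1≤count _ n i<n Pfi) (count-tail f n)

  2≤count : ∀ f n {i j} → i < j → j < n → P (f i) → P (f j) → 2 ≤ count f n
  2≤count f (suc n) {zero}  (s≤s _)   (s≤s j<n) Pfi Pfj =
    subst (2 ≤_) (sym (count-accept f n Pfi)) (s≤s (1≤count _ n j<n Pfj))
  2≤count f (suc n) {suc i} (s≤s i<j) (s≤s j<n) Pfi Pfj =
    ≤-trans (2≤count _ n i<j j<n Pfi Pfj) (count-tail f n)

  3≤count : ∀ f n {i j} → 0 < i → i < j → j < n → P (f 0) → P (f i) → P (f j) → 3 ≤ count f n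
  3≤count f (suc n) {suc i} _ (s≤s i<j) (s≤s j<n) Pf0 Pfi Pfj =
    subst (3 ≤_) (sym (count-accept f n Pf0)) (s≤s (2≤count _ n i<j j<n Pfi Pfj))

-- The morphism: injectivity and palindromes.

module Morphism (m : ℕ) (2≤m : 2 ≤ m) where

  open Bonacci m 2≤m

  toℕ-𝟎 : toℕ 𝟎 ≡ 0
  toℕ-𝟎 = Fin.toℕ-fromℕ< _

  -- Relates letters through `toℕ`, which keeps the bound proof inside `fromℕ<` out of later case
  -- splits.
  data φ-View (i : Letter) : Word → Set where
    two : ∀ {j} → toℕ j ≡ suc (toℕ i) → φ-View i (𝟎 ∷ j ∷ [])
    one : suc (toℕ i) ≡ m → φ-View i [ 𝟎 ]

  φ-view : ∀ i → φ-View i (φ i)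
  φ-view i with suc (toℕ i) <? m
  ... | yes i+1<m = two (Fin.toℕ-fromℕ< i+1<m)
  ... | no  i+1≮m = one (≤-antisym (Fin.toℕ<n i) (≮⇒≥ i+1≮m))

  successor≢𝟎 : ∀ {i j : Letter} → toℕ j ≡ suc (toℕ i) → j ≢ 𝟎
  successor≢𝟎 eq refl = 0≢1+n (trans (sym toℕ-𝟎) eq)

  φ*-∷ʳ : ∀ w a → φ* (w ∷ʳ a) ≡ φ* w ++ φ a
  φ*-∷ʳ w a = trans (List.concatMap-++ φ w [ a ]) (cong (φ* w ++_) (List.++-identityʳ (φ a)))

  -- For one letter, 0 φ(a)ᴿ = φ(a) 0; the leading 0 passes through the blocks one after another and
  -- comes out at the right end.
  𝟎∷-reverse-φ* : ∀ w → 𝟎 ∷ reverse (φ* w) ≡ φ* (reverse w) ∷ʳ 𝟎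
  𝟎∷-reverse-φ* []      = refl
  𝟎∷-reverse-φ* (a ∷ w) = begin
    𝟎 ∷ reverse (φ a ++ φ* w)              ≡⟨ cong (𝟎 ∷_) (List.reverse-++ (φ a) (φ* w)) ⟩
    (𝟎 ∷ reverse (φ* w)) ++ reverse (φ a)  ≡⟨ cong (_++ reverse (φ a)) (𝟎∷-reverse-φ* w) ⟩
    (φ* (reverse w) ∷ʳ 𝟎) ++ reverse (φ a) ≡⟨ List.++-assoc (φ* (reverse w)) _ _ ⟩
    φ* (reverse w) ++ 𝟎 ∷ reverse (φ a)    ≡⟨ cong (φ* (reverse w) ++_) (conjugate (φ-view a)) ⟩
    φ* (reverse w) ++ (φ a ∷ʳ 𝟎)           ≡⟨ List.++-assoc (φ* (reverse w)) _ _ ⟨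
    (φ* (reverse w) ++ φ a) ∷ʳ 𝟎           ≡⟨ cong (_∷ʳ 𝟎) (φ*-∷ʳ (reverse w) a) ⟨
    φ* (reverse w ∷ʳ a) ∷ʳ 𝟎               ≡⟨ cong (λ v → φ* v ∷ʳ 𝟎) (List.unfold-reverse a w) ⟨
    φ* (reverse (a ∷ w)) ∷ʳ 𝟎              ∎
    where
    open ≡-Reasoning
    conjugate : ∀ {v} → φ-View a v → 𝟎 ∷ reverse v ≡ v ∷ʳ 𝟎
    conjugate (two _) = refl
    conjugate (one _) = refl

  reverse-φ*-∷ʳ : ∀ w → reverse (φ* w ∷ʳ 𝟎) ≡ φ* (reverse w) ∷ʳ 𝟎
  reverse-φ*-∷ʳ w = trans (List.reverse-++ (φ* w) [ 𝟎 ]) (𝟎∷-reverse-φ* w)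

  φ*-starts-𝟎 : ∀ v {a w} → φ* v ≡ a ∷ w → a ≡ 𝟎
  φ*-starts-𝟎 (b ∷ v) eq with φ b | φ-view b
  ... | _ | two _ = sym (List.∷-injectiveˡ eq)
  ... | _ | one _ = sym (List.∷-injectiveˡ eq)

  -- Every block begins with 0 and a second letter is never 0, so block boundaries can be read off.
  -- A block of length two reveals its letter by its second letter; only m - 1 has a block of length
  -- one.
  φ*-injective : ∀ v w → φ* v ≡ φ* w → v ≡ w
  φ*-injective []      []      _  = refl
  φ*-injective []      (b ∷ w) eq with φ b | φ-view b
  φ*-injective []      (b ∷ w) () | _ | two _
  φ*-injective []      (b ∷ w) () | _ | one _
  φ*-injective (a ∷ v) []      eq with φ a | φ-view a
  φ*-injective (a ∷ v) []      () | _ | two _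
  φ*-injective (a ∷ v) []      () | _ | one _
  φ*-injective (a ∷ v) (b ∷ w) eq with φ a | φ-view a | φ b | φ-view b
  ... | _ | two p | _ | two q = cong₂ _∷_
    (Fin.toℕ-injective (suc-injective
      (trans (sym p) (trans (cong toℕ (List.∷-injectiveˡ (List.∷-injectiveʳ eq))) q))))
    (φ*-injective v w (List.∷-injectiveʳ (List.∷-injectiveʳ eq)))
  ... | _ | two p | _ | one q = ⊥-elim (successor≢𝟎 p (φ*-starts-𝟎 w (sym (List.∷-injectiveʳ eq))))
  ... | _ | one p | _ | two q = ⊥-elim (successor≢𝟎 q (φ*-starts-𝟎 v (List.∷-injectiveʳ eq)))
  ... | _ | one p | _ | one q = cong₂ _∷_
    (Fin.toℕ-injective (suc-injective (trans p (sym q))))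
    (φ*-injective v w (List.∷-injectiveʳ eq))

  palindrome-φ*⁺ : ∀ w → Palindrome w → Palindrome (φ* w ∷ʳ 𝟎)
  palindrome-φ*⁺ w pal = trans (reverse-φ*-∷ʳ w) (cong (λ v → φ* v ∷ʳ 𝟎) pal)

  palindrome-φ*⁻ : ∀ w → Palindrome (φ* w ∷ʳ 𝟎) → Palindrome w
  palindrome-φ*⁻ w pal = φ*-injective (reverse w) w
    (List.∷ʳ-injectiveˡ _ _ (trans (sym (reverse-φ*-∷ʳ w)) pal))

-- Block decomposition of the fixed point.

module FixedPoint (m : ℕ) (2≤m : 2 ≤ m) (x : ℕ → Fin m) (isx : Bonacci.Is-hω m 2≤m x) where

  open Bonacci m 2≤m
  open Morphism m 2≤m
  open Is-hω isx

  pref : ℕ → Word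
  pref = applyUpTo x

  -- The position in x at which the image of the letter x n starts.
  f : ℕ → ℕ
  f n = length (φ* (pref n))

  f-suc : ∀ n → φ* (pref (suc n)) ≡ φ* (pref n) ++ φ (x n)
  f-suc n = trans (cong φ* (sym (List.applyUpTo-∷ʳ x n))) (φ*-∷ʳ (pref n) (x n))

  ∣f-suc∣ : ∀ n → f (suc n) ≡ f n + length (φ (x n))
  ∣f-suc∣ n = trans (cong length (f-suc n)) (List.length-++ (φ* (pref n)))

  -- `fixed` makes the image of a prefix a prefix of `x`; cancelling the image of the shorter prefix
  -- locates `v` at position `f i`.
  split-fixed : ∀ i n v → φ* (pref n) ≡ φ* (pref i) ++ v →
    v ≡ applyUpTo (λ r → x (f i + r)) (length v)
  split-fixed i n v eq = List.++-cancelˡ (φ* (pref i)) _ _ (begin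
    φ* (pref i) ++ v                                  ≡⟨ eq ⟨
    φ* (pref n)                                       ≡⟨ fixed n ⟩
    pref (f n)                                        ≡⟨ cong pref (cong length eq) ⟩
    pref (length (φ* (pref i) ++ v))                  ≡⟨ cong pref (List.length-++ (φ* (pref i))) ⟩
    pref (f i + length v)                             ≡⟨ applyUpTo-+ x (f i) (length v) ⟩
    pref (f i) ++ rest                                ≡⟨ cong (_++ rest) (fixed i) ⟨
    φ* (pref i) ++ rest                               ∎)
    where
    open ≡-Reasoning
    rest = applyUpTo (λ r → x (f i + r)) (length v)

  data Block (i : ℕ) : Set where
    two : toℕ (x (suc (f i))) ≡ suc (toℕ (x i)) → f (suc i) ≡ suc (suc (f i)) → Block i
    one : suc (toℕ (x i)) ≡ m → f (suc i) ≡ suc (f i) → Block i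

  block-structure : ∀ i → x (f i) ≡ 𝟎 × Block i
  block-structure i with φ (x i) | φ-view (x i) | split-fixed i (suc i) (φ (x i)) (f-suc i) | ∣f-suc∣ i
  ... | _ | two p | eq | len =
    trans (cong x (sym (+-identityʳ (f i)))) (sym (List.∷-injectiveˡ eq)) ,
    two (trans (cong toℕ (trans (cong x (+-comm 1 (f i)))
          (sym (List.∷-injectiveˡ (List.∷-injectiveʳ eq))))) p)
        (trans len (+-comm (f i) 2))
  ... | _ | one p | eq | len =
    trans (cong x (sym (+-identityʳ (f i)))) (sym (List.∷-injectiveˡ eq)) ,
    one p (trans len (+-comm (f i) 1))

  block-starts-𝟎 : ∀ i → x (f i) ≡ 𝟎
  block-starts-𝟎 i = proj₁ (block-structure i)

  block : ∀ i → Block i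
  block i = proj₂ (block-structure i)

  block-end-𝟎 : ∀ i → f (suc i) ≡ suc (f i) → x (suc (f i)) ≡ 𝟎
  block-end-𝟎 i len = trans (cong x (sym len)) (block-starts-𝟎 (suc i))

  f-inc : ∀ i → f i < f (suc i)
  f-inc i with block i
  ... | two _ len = subst (f i <_) (sym len) (m≤n⇒m≤1+n ≤-refl)
  ... | one _ len = subst (f i <_) (sym len) ≤-refl

  f-mono : ∀ i j → i ≤ j → f i ≤ f j
  f-mono i zero     z≤n = ≤-refl
  f-mono i (suc j) i≤1+j with m≤n⇒m<n∨m≡n i≤1+j
  ... | inj₁ (s≤s i≤j) = ≤-trans (f-mono i j i≤j) (<⇒≤ (f-inc j))
  ... | inj₂ refl      = ≤-refl

  n≤f : ∀ n → n ≤ f n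
  n≤f zero    = z≤n
  n≤f (suc n) = ≤-trans (s≤s (n≤f n)) (f-inc n)

  -- φ(a)0 determines a: its second letter is a + 1 modulo m.
  block-determines : ∀ {i j} → x (suc (f i)) ≡ x (suc (f j)) → x i ≡ x j
  block-determines {i} {j} eq with block i | block j
  ... | two p _ | two q _ = Fin.toℕ-injective (suc-injective (trans (sym p) (trans (cong toℕ eq) q)))
  ... | two p _ | one _ l = ⊥-elim (successor≢𝟎 p (trans eq (block-end-𝟎 j l)))
  ... | one _ l | two q _ = ⊥-elim (successor≢𝟎 q (trans (sym eq) (block-end-𝟎 i l)))
  ... | one p _ | one q _ = Fin.toℕ-injective (suc-injective (trans p (sym q)))

  -- Carrying along that second positions hold a nonzero letter makes 0 a marker of block starts, as
  -- `𝟎⇒block-start` requires.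
  in-block : ∀ j → ∃[ i ] (f i ≡ j ⊎ (suc (f i) ≡ j × x j ≢ 𝟎 × f (suc i) ≡ suc j))
  in-block zero = 0 , inj₁ refl
  in-block (suc j) with in-block j
  ... | i , inj₂ (_ , _ , e) = suc i , inj₁ e
  ... | i , inj₁ refl with block i
  ...   | two p e = i , inj₂ (refl , successor≢𝟎 p , e)
  ...   | one _ e = suc i , inj₁ e

  𝟎⇒block-start : ∀ {j} → x j ≡ 𝟎 → ∃[ i ] f i ≡ j
  𝟎⇒block-start {j} xj≡𝟎 with in-block j
  ... | i , inj₁ e            = i , e
  ... | i , inj₂ (_ , ≢𝟎 , _) = ⊥-elim (≢𝟎 xj≡𝟎)

  -- Transport of occurrences of prefixes along the morphism.

  Recurs : ℕ → ℕ → Set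
  Recurs i n = ∀ {r} → r < n → x (i + r) ≡ x r

  recurs-≤ : ∀ {i k n} → k ≤ n → Recurs i n → Recurs i k
  recurs-≤ k≤n rec r<k = rec (≤-trans r<k k≤n)

  recurs⇒𝟎 : ∀ {i n} → Recurs i (suc n) → x i ≡ 𝟎
  recurs⇒𝟎 {i} rec = trans (trans (cong x (sym (+-identityʳ i))) (rec (s≤s z≤n))) start

  φ*-recurs : ∀ i n → Recurs i n → φ* (pref (i + n)) ≡ φ* (pref i) ++ φ* (pref n)
  φ*-recurs i n rec = trans
    (cong φ* (trans (applyUpTo-+ x i n) (cong (pref i ++_) (applyUpTo-cong n rec))))
    (List.concatMap-++ φ (pref i) (pref n))

  f-+ : ∀ i n → Recurs i n → f (i + n) ≡ f i + f n
  f-+ i n rec = trans (cong length (φ*-recurs i n rec)) (List.length-++ (φ* (pref i)))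

  -- The image of an occurrence at `i` is an occurrence at `f i`; the letter gained is the 0 that
  -- opens the block following each copy.
  recurs-φ⁺ : ∀ i n → Recurs i n → Recurs (f i) (suc (f n))
  recurs-φ⁺ i n rec {r} (s≤s r≤fn) with m≤n⇒m<n∨m≡n r≤fn
  ... | inj₁ r<fn = applyUpTo-injective (f n)
    (trans (sym (split-fixed i (i + n) (φ* (pref n)) (φ*-recurs i n rec))) (fixed n)) r<fn
  ... | inj₂ refl = trans (trans (cong x (sym (f-+ i n rec))) (block-starts-𝟎 (i + n)))
    (sym (block-starts-𝟎 n))

  -- The last matching letter, at index `f n + 1`, is the second letter of φ(x n)0 and so determines
  -- `x n`. The earlier letters come by induction and give the alignment `f (i + n) = f i + f n`.
  recurs-φ⁻ : ∀ i n → Recurs (f i) (suc (suc (f n))) → Recurs i (suc n)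
  recurs-φ⁻ i n rec {r} (s≤s r≤n) with m≤n⇒m<n∨m≡n r≤n
  recurs-φ⁻ i (suc n) rec (s≤s _) | inj₁ r<n =
    recurs-φ⁻ i n (recurs-≤ (s≤s (m≤n⇒m≤1+n (f-inc n))) rec) r<n
  recurs-φ⁻ i n rec (s≤s _) | inj₂ refl = block-determines (begin
    x (suc (f (i + n)))   ≡⟨ cong (λ k → x (suc k)) (f-+ i n (below n rec)) ⟩
    x (suc (f i + f n))   ≡⟨ cong x (+-suc (f i) (f n)) ⟨
    x (f i + suc (f n))   ≡⟨ rec ≤-refl ⟩
    x (suc (f n))         ∎)
    where
    open ≡-Reasoning
    -- The recursive call again, now for all smaller indices at once, as `f-+` demands.
    below : ∀ n → Recurs (f i) (suc (suc (f n))) → Recurs i n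
    below zero    _   ()
    below (suc n) rec = recurs-φ⁻ i n (recurs-≤ (s≤s (m≤n⇒m≤1+n (f-inc n))) rec)

  -- The lengths of the words h_k and of the palindromic prefixes.

  H : ℕ → ℕ
  H zero    = 1
  H (suc k) = f (H k)

  -- The recursion mirrors the step from v to φ(v)0; `L-suc` recovers the sum of the `H i`.
  L : ℕ → ℕ
  L zero    = 0
  L (suc k) = suc (f (L k))

  h≡pref : ∀ k → h k ≡ pref (H k)
  h≡pref zero    = cong [_] (sym start)
  h≡pref (suc k) = trans (cong φ* (h≡pref k)) (fixed (H k))

  ∣h∣ : ∀ k → length (h k) ≡ H k
  ∣h∣ k = trans (cong length (h≡pref k)) (List.length-applyUpTo x (H k))

  0<H : ∀ k → 0 < H k
  0<H zero    = s≤s z≤n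
  0<H (suc k) = ≤-trans (0<H k) (n≤f (H k))

  recurs-H : ∀ k → Recurs (H k) (L k)
  recurs-H zero    ()
  recurs-H (suc k) = recurs-φ⁺ (H k) (L k) (recurs-H k)

  L-suc : ∀ k → L (suc k) ≡ H k + L k
  L-suc zero    = refl
  L-suc (suc k) = trans (cong (λ n → suc (f n)) (L-suc k))
    (trans (cong suc (f-+ (H k) (L k) (recurs-H k))) (sym (+-suc _ _)))

  L-inc : ∀ k → L k < L (suc k)
  L-inc k = subst (L k <_) (sym (L-suc k)) (+-monoˡ-≤ (L k) (0<H k))

  L-mono : ∀ {i j} → i ≤ j → L i ≤ L j
  L-mono {j = zero}  z≤n = ≤-refl
  L-mono {j = suc j} i≤1+j with m≤n⇒m<n∨m≡n i≤1+j
  ... | inj₁ (s≤s i≤j) = ≤-trans (L-mono i≤j) (<⇒≤ (L-inc j))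
  ... | inj₂ refl      = ≤-refl

  toℕ-x0 : toℕ (x 0) ≡ 0
  toℕ-x0 = trans (cong toℕ start) toℕ-𝟎

  -- The block of the letter at `L k` starts at `f (L k)`, so its second letter sits at `L (suc k)`:
  -- the letter goes up by one at each step until m - 1.
  x-L : ∀ k → k < m → toℕ (x (L k)) ≡ k
  x-L zero    _     = toℕ-x0
  x-L (suc k) 1+k<m with block (L k)
  ... | two p _ = trans p (cong suc (x-L k (<⇒≤ 1+k<m)))
  ... | one p _ = ⊥-elim (<-irrefl (trans (cong suc (sym (x-L k (<⇒≤ 1+k<m)))) p) 1+k<m)

  -- While the letter at `L k` is below m - 1, its block of length two carries the surplus of one
  -- over to `suc k`.
  H-small : ∀ k → k < m → H k ≡ suc (L k)
  H-small zero    _     = refl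
  H-small (suc k) 1+k<m with block (L k)
  ... | two _ e = trans (cong f (H-small k (<⇒≤ 1+k<m))) e
  ... | one p _ = ⊥-elim (<-irrefl (trans (cong suc (sym (x-L k (<⇒≤ 1+k<m)))) p) 1+k<m)

  -- Here the letter at `L k` is m - 1, whose block has length one, and the surplus disappears.
  H-m : ∀ k → suc k ≡ m → H (suc k) ≡ L (suc k)
  H-m k refl with block (L k)
  ... | two p _ = ⊥-elim (<-irrefl (trans p (cong suc (x-L k ≤-refl))) (Fin.toℕ<n _))
  ... | one _ e = trans (cong f (H-small k ≤-refl)) e

  -- Start from `H-m` and apply `f` to both sides; it splits over the sum because the prefix of
  -- length `L a` recurs at `H (a + suc k)`.
  H-large : ∀ a k → suc k ≡ m → H (a + suc k) + L a ≡ L (a + suc k)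
  H-large zero    k eq = trans (+-identityʳ _) (H-m k eq)
  H-large (suc a) k eq = trans (+-suc _ _) (cong suc (trans
    (sym (f-+ (H n) (L a) (recurs-≤ (L-mono (m≤m+n a (suc k))) (recurs-H n))))
    (cong f (H-large a k eq))))
    where n = a + suc k

  -- Descent: an occurrence starts with 0, hence at some `f i`, and `L (suc k) + 1 = f (L k) + 2` is
  -- just the length that `recurs-φ⁻` pulls back to an occurrence at `i`. Monotonicity of `f` pulls
  -- back the bound on the position. For `k = 0`, the first block start after 0 is `f 1 = H 1`.
  no-early-return : ∀ k j → 0 < j → j < H (suc k) → ¬ Recurs j (suc (L k))
  no-early-return zero j 0<j j<H rec with 𝟎⇒block-start (recurs⇒𝟎 rec)
  ... | zero  , refl = <-irrefl refl 0<j
  ... | suc i , refl = <⇒≱ j<H (f-mono 1 (suc i) (s≤s z≤n))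
  no-early-return (suc k) j 0<j j<H rec with 𝟎⇒block-start (recurs⇒𝟎 rec)
  ... | zero  , refl = <-irrefl refl 0<j
  ... | suc i , refl with suc i <? H (suc k)
  ...   | yes i<H = no-early-return k (suc i) (s≤s z≤n) i<H (recurs-φ⁻ (suc i) (L k) rec)
  ...   | no  i≮H = <⇒≱ j<H (f-mono (H (suc k)) (suc i) (≮⇒≥ i≮H))

  -- Palindromic prefixes.

  φ*-pref-∷ʳ : ∀ n → φ* (pref n) ∷ʳ 𝟎 ≡ pref (suc (f n))
  φ*-pref-∷ʳ n = trans (cong₂ _∷ʳ_ (fixed n) (sym (block-starts-𝟎 n))) (List.applyUpTo-∷ʳ x (f n))

  pref-L-palindrome : ∀ k → Palindrome (pref (L k))
  pref-L-palindrome zero    = refl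
  pref-L-palindrome (suc k) = subst Palindrome (φ*-pref-∷ʳ (L k)) (palindrome-φ*⁺ _ (pref-L-palindrome k))

  -- A nonempty palindromic prefix ends with its first letter 0. That 0 opens a block, so the prefix
  -- is φ(v)0 for a shorter prefix v, itself a palindrome by `palindrome-φ*⁻`.
  palindrome⇒L : ∀ ℓ → Palindrome (pref ℓ) → ∃[ k ] ℓ ≡ L k
  palindrome⇒L = <-rec _ go
    where
    go : ∀ ℓ → (∀ {i} → i < ℓ → Palindrome (pref i) → ∃[ k ] i ≡ L k) →
         Palindrome (pref ℓ) → ∃[ k ] ℓ ≡ L k
    go zero    _  _   = 0 , refl
    go (suc ℓ) ih pal with 𝟎⇒block-start xℓ≡𝟎
      where
      xℓ≡𝟎 : x ℓ ≡ 𝟎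
      xℓ≡𝟎 = trans (List.∷-injectiveˡ (trans (sym (List.reverse-++ (pref ℓ) [ x ℓ ]))
        (trans (cong reverse (List.applyUpTo-∷ʳ x ℓ)) pal))) start
    ... | i , refl with ih (s≤s (n≤f i)) (palindrome-φ*⁻ (pref i) (subst Palindrome (sym (φ*-pref-∷ʳ i)) pal))
    ...   | k , refl = suc k , refl

  -- Lengths of the words t_n.

  ∣hᴿ∣ : ∀ a k → L a + length (hᴿ a k) ≡ L (a + k)
  ∣hᴿ∣ a zero    = trans (+-identityʳ (L a)) (cong L (sym (+-identityʳ a)))
  ∣hᴿ∣ a (suc k) = begin
    L a + length (hᴿ a (suc k))            ≡⟨ cong (λ w → L a + length w) hᴿ-suc ⟩
    L a + length (hᴿ a k ++ reverse (h (a + k))) ≡⟨ cong (L a +_) (List.length-++ (hᴿ a k)) ⟩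
    L a + (length (hᴿ a k) + length (reverse (h (a + k))))
      ≡⟨ cong (λ n → L a + (length (hᴿ a k) + n)) (trans (List.length-reverse (h (a + k))) (∣h∣ (a + k))) ⟩
    L a + (length (hᴿ a k) + H (a + k))    ≡⟨ +-assoc (L a) _ _ ⟨
    L a + length (hᴿ a k) + H (a + k)      ≡⟨ cong (_+ H (a + k)) (∣hᴿ∣ a k) ⟩
    L (a + k) + H (a + k)                  ≡⟨ +-comm (L (a + k)) _ ⟩
    H (a + k) + L (a + k)                  ≡⟨ L-suc (a + k) ⟨
    L (suc (a + k))                        ≡⟨ cong L (+-suc a k) ⟨
    L (a + suc k)                          ∎
    where
    open ≡-Reasoning
    g = λ j → reverse (h (a + j))
    hᴿ-suc : hᴿ a (suc k) ≡ hᴿ a k ++ reverse (h (a + k))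
    hᴿ-suc = trans (cong (concatMap g) (sym (List.upTo-∷ʳ k)))
      (trans (List.concatMap-++ g (upTo k) [ k ]) (cong (hᴿ a k ++_) (List.++-identityʳ (g k))))

  ∣t∣ : ∀ k → length (t (suc (suc k))) + H k ≡ H (suc k)
  ∣t∣ k with suc k <? m
  ... | yes 1+k<m = begin
    suc (length (hᴿ 0 k) + H k) ≡⟨ cong (λ n → suc (n + H k)) (∣hᴿ∣ 0 k) ⟩
    suc (L k + H k)             ≡⟨ cong suc (+-comm (L k) (H k)) ⟩
    suc (H k + L k)             ≡⟨ cong suc (L-suc k) ⟨
    suc (L (suc k))             ≡⟨ H-small (suc k) 1+k<m ⟨
    H (suc k)                   ∎
    where open ≡-Reasoning
  -- Adding `L a` turns the length of the product into `L k`, and `H (suc k)` into `L (suc k)`.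
  ... | no 1+k≮m = +-cancelʳ-≡ (L a) _ _ (begin
    T + H k + L a         ≡⟨ rearrange T (H k) (L a) ⟩
    H k + (L a + T)       ≡⟨ cong (H k +_) (∣hᴿ∣ a (m ∸ 1)) ⟩
    H k + L (a + (m ∸ 1)) ≡⟨ cong (λ n → H k + L n) (suc-injective (trans (sym (+-suc a (m ∸ 1))) a+m)) ⟩
    H k + L k             ≡⟨ L-suc k ⟨
    L (suc k)             ≡⟨ cong L a+m ⟨
    L (a + suc (m ∸ 1))   ≡⟨ H-large a (m ∸ 1) 1+m∸1 ⟨
    H (a + suc (m ∸ 1)) + L a ≡⟨ cong (λ n → H n + L a) a+m ⟩
    H (suc k) + L a       ∎)
    where
    open ≡-Reasoning
    a = suc k ∸ m
    T = length (hᴿ a (m ∸ 1))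
    1+m∸1 : suc (m ∸ 1) ≡ m
    1+m∸1 = m+[n∸m]≡n (<⇒≤ 2≤m)
    a+m : a + suc (m ∸ 1) ≡ suc k
    a+m = trans (cong (a +_) 1+m∸1) (m∸n+n≡m (≮⇒≥ 1+k≮m))
    rearrange : ∀ p q r → p + q + r ≡ q + (r + p)
    rearrange = solve-∀

  -- Occurrences inside a prefix; closed and open prefixes.

  module _ (p N : ℕ) where

    P? : Decidable (Prefix _≡_ (pref p))
    P? = Prefix.prefix? Fin._≟_ (pref p)

    window : ℕ → Word
    window j = applyUpTo (λ r → x (j + r)) (N ∸ j)

    occurrences-count : occurrences (pref p) (pref N) ≡ count P? window (suc N)
    occurrences-count = cong (λ ws → length (filter P? ws)) (tails-applyUpTo x N)

    occurs⁺ : ∀ j → j + p ≤ N → Recurs j p → Prefix _≡_ (pref p) (window j)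
    occurs⁺ j j+p≤N rec = prefix-applyUpTo⁺ (m+n≤o⇒m≤o∸n p (subst (_≤ N) (+-comm j p) j+p≤N)) (λ r<p → sym (rec r<p))

    occurs⁻ : ∀ j → j ≤ N → Prefix _≡_ (pref p) (window j) → j + p ≤ N × Recurs j p
    occurs⁻ j j≤N occ with prefix-applyUpTo⁻ p (N ∸ j) occ
    ... | p≤ , eq = subst (j + p ≤_) (m+[n∸m]≡n j≤N) (+-monoʳ-≤ j p≤) , λ r<p → sym (eq r<p)

  pref-nonempty : ∀ {n} → 0 < n → pref n ≢ []
  pref-nonempty (s≤s _) ()

  closed-prefix : ∀ k N → L k + H (suc k) < N → N ≤ L (suc (suc k)) → Closed (pref N)
  closed-prefix k N L+H<N N≤ = pref-nonempty 0<N , inj₂ (pref p , border , occ)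
    where
    q = H (suc k)
    p = N ∸ q
    q≤N : q ≤ N
    q≤N = ≤-trans (m≤n+m q (L k)) (<⇒≤ L+H<N)
    q+p : q + p ≡ N
    q+p = m+[n∸m]≡n q≤N
    0<N : 0 < N
    0<N = ≤-trans (0<H (suc k)) q≤N
    -- Long enough for `no-early-return`; the next bound makes it short enough to recur at `q`.
    L<p : L k < p
    L<p = +-cancelʳ-≤ q _ _ (≤-trans L+H<N (≤-reflexive (trans (sym q+p) (+-comm q p))))
    p≤L : p ≤ L (suc k)
    p≤L = +-cancelˡ-≤ q _ _ (subst₂ _≤_ (sym q+p) (L-suc (suc k)) N≤)
    rec : Recurs q p
    rec = recurs-≤ p≤L (recurs-H (suc k))
    p≤N = ≤-trans (m≤n+m p q) (≤-reflexive q+p)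
    border : Border (pref p) (pref N)
    border = pref-nonempty (≤-trans (s≤s z≤n) L<p)
           , prefix-applyUpTo⁺ p≤N (λ _ → refl)
           , subst₂ (Suffix _≡_) (applyUpTo-cong p rec) (cong pref q+p) (suffix-applyUpTo⁺ x q p)
    only : ∀ {j} → 0 < j → j < suc N → Prefix _≡_ (pref p) (window p N j) → j ≡ q
    only {j} 0<j (s≤s j≤N) o with occurs⁻ p N j j≤N o
    ... | j+p≤N , rec′ with <-cmp j q
    -- Before `q` the border is too long to return; after `q` it would stick out of the word.
    ...   | tri< j<q _ _ = ⊥-elim (no-early-return k j 0<j j<q (recurs-≤ L<p rec′))
    ...   | tri≈ _ j≡q _ = j≡q
    ...   | tri> _ _ q<j = ⊥-elim (<⇒≱ (+-monoˡ-< p q<j) (≤-trans j+p≤N (≤-reflexive (sym q+p))))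
    occ : occurrences (pref p) (pref N) ≡ 2
    occ = trans (occurrences-count p N)
      (count≡2 (P? p N) (window p N) (suc N) (0<H (suc k)) (s≤s q≤N)
        (occurs⁺ p N 0 p≤N (λ _ → refl))
        (occurs⁺ p N q (≤-reflexive q+p) rec)
        only)

  open-prefix : ∀ k N → L (suc k) < N → N ≤ L k + H (suc k) → Open (pref N)
  open-prefix k N L<N N≤ = pref-nonempty (≤-trans (s≤s z≤n) L<N) , notClosed
    where
    module _ (p j : ℕ) (0<p : 0 < p) (j+p : j + p ≡ N) (rec : Recurs j p) where
      p≤N : p ≤ N
      p≤N = ≤-trans (m≤n+m p j) (≤-reflexive j+p)
      occ-0 : Prefix _≡_ (pref p) (window p N 0)
      occ-0 = occurs⁺ p N 0 p≤N (λ _ → refl)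
      twice : occurrences (pref p) (pref N) ≢ 2
      twice eq with j ≟ 0
      -- At offset 0 the border is the whole word, which occurs only once.
      ... | yes refl = 1+n≢n (trans (sym eq) (trans (occurrences-count p N)
        (count≡1 (P? p N) (window p N) (suc N) {0} (s≤s z≤n) occ-0
          λ { {i} (s≤s i≤N) o → n≤0⇒n≡0 (+-cancelʳ-≤ p _ _
            (≤-trans (proj₁ (occurs⁻ p N i i≤N o)) (≤-reflexive (sym j+p)))) })))
      ... | no j≢0 with p ≤? L k
      -- A short border occurs a third time at `H k`, which precedes `j`: `H k + p` is at most
      -- `L (suc k)`, hence below `N = j + p`.
      ...   | yes p≤L = <-irrefl (trans (sym eq) (occurrences-count p N))
        (3≤count (P? p N) (window p N) (suc N) (0<H k) H<j (s≤s (≤-trans (m≤m+n j p) (≤-reflexive j+p)))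
          occ-0
          (occurs⁺ p N (H k) (<⇒≤ H+p<N) (recurs-≤ p≤L (recurs-H k)))
          (occurs⁺ p N j (≤-reflexive j+p) rec))
        where
        H+p<N : H k + p < N
        H+p<N = ≤-<-trans (+-monoʳ-≤ (H k) p≤L) (subst (_< N) (L-suc k) L<N)
        H<j : H k < j
        H<j = +-cancelʳ-< p _ _ (subst (H k + p <_) (sym j+p) H+p<N)
      -- A border longer than `L k` cannot return before `H (suc k)`; returning later, it would push
      -- `N` beyond `L k + H (suc k)`.
      ...   | no p≰L with j <? H (suc k)
      ...     | yes j<H = no-early-return k j (n≢0⇒n>0 j≢0) j<H (recurs-≤ (≰⇒> p≰L) rec)
      ...     | no  j≮H = <⇒≱ (+-mono-<-≤ (≰⇒> p≰L) (≮⇒≥ j≮H))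
        (≤-trans (≤-reflexive (trans (+-comm p j) j+p)) N≤)

    0<∣_∣ : ∀ v → v ≢ [] → 0 < length v
    0<∣ []    ∣ v≢[] = ⊥-elim (v≢[] refl)
    0<∣ _ ∷ _ ∣ _    = s≤s z≤n

    notClosed : ¬ Closed (pref N)
    notClosed (_ , inj₁ len) = <⇒≱ L<N (≤-trans (≤-reflexive (trans (sym (List.length-applyUpTo x N)) len)) (s≤s z≤n))
    notClosed (_ , inj₂ (v , (v≢[] , pre , suf) , eq)) with suffix-applyUpTo⁻ x N suf
    ... | j , j+p , v≡ = twice p j (0<∣ v ∣ v≢[]) j+p
        (applyUpTo-injective p (trans (sym v≡) v≡pref))
        (subst (λ w → occurrences w (pref N) ≡ 2) v≡pref eq)
      where
      p = length v
      v≡pref = prefix-of-applyUpTo N pre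

  -- The sequence of palindromic prefixes and the two types.

  module _ (u : ℕ → Word) (isu : IsPalindromicPrefixSequence x u) where

    open IsPalindromicPrefixSequence isu

    ∣u∣-mono : ∀ {i j} → i ≤ j → length (u (suc i)) ≤ length (u (suc j))
    ∣u∣-mono {j = zero}  z≤n = ≤-refl
    ∣u∣-mono {j = suc j} i≤1+j with m≤n⇒m<n∨m≡n i≤1+j
    ... | inj₁ (s≤s i≤j) = ≤-trans (∣u∣-mono i≤j) (<⇒≤ (increasing (suc j) (s≤s z≤n)))
    ... | inj₂ refl      = ≤-refl

    ∣u∣-is-L : ∀ n → ∃[ k ] length (u (suc n)) ≡ L k
    ∣u∣-is-L n with sound (suc n) (s≤s z≤n)
    ... | u≺x , pal = palindrome⇒L _ (subst Palindrome u≺x pal)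

    L-is-∣u∣ : ∀ k → ∃[ n ] length (u (suc n)) ≡ L k
    L-is-∣u∣ k with complete (pref (L k))
      (cong pref (sym (List.length-applyUpTo x (L k))) , pref-L-palindrome k)
    ... | suc n , _ , eq = n , trans (cong length eq) (List.length-applyUpTo x (L k))

    -- Both sides increase strictly and take the same values. The value of either side at `suc n`
    -- appears in the other sequence, necessarily beyond index `n`, which gives the two
    -- inequalities.
    ∣u∣ : ∀ n → length (u (suc n)) ≡ L n
    ∣u∣ zero    = cong length first
    ∣u∣ (suc n) with ∣u∣-is-L (suc n) | L-is-∣u∣ (suc n)
    ... | j , u≡Lj | i , ui≡L = ≤-antisym
      (≤-trans (∣u∣-mono n<i) (≤-reflexive ui≡L))
      (≤-trans (L-mono n<j) (≤-reflexive (sym u≡Lj)))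
      where
      n<i : n < i
      n<i = ≰⇒> λ i≤n → <⇒≱ (L-inc n) (subst₂ _≤_ ui≡L (∣u∣ n) (∣u∣-mono i≤n))
      n<j : n < j
      n<j = ≰⇒> λ j≤n → <⇒≱ (subst₂ _<_ (∣u∣ n) u≡Lj (increasing (suc n) (s≤s z≤n))) (L-mono j≤n)

    ∣u∣+∣t∣ : ∀ k → length (u (suc (suc k))) + length (t (suc (suc k))) ≡ L k + H (suc k)
    ∣u∣+∣t∣ k = begin
      length (u (suc (suc k))) + T ≡⟨ cong (_+ T) (trans (∣u∣ (suc k)) (L-suc k)) ⟩
      H k + L k + T                ≡⟨ rearrange (H k) (L k) T ⟩
      L k + (T + H k)              ≡⟨ cong (L k +_) (∣t∣ k) ⟩
      L k + H (suc k)              ∎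
      where
      open ≡-Reasoning
      T = length (t (suc (suc k)))
      rearrange : ∀ p q r → p + q + r ≡ q + (r + p)
      rearrange = solve-∀

    type-1-closed : ∀ w → Type-1 x u w → Closed w
    type-1-closed w record { n = zero ; index = () , _ }
    -- For n = 1 the length is at most `L 1`, which is 1, so the word is a single letter.
    type-1-closed w record { nonempty = w≢[] ; n = suc zero ; lower = 0<w ; upper = w≤1 } =
      w≢[] , inj₁ (≤-antisym (≤-trans w≤1 (≤-reflexive (∣u∣ 1))) (m<n⇒0<n 0<w))
    type-1-closed w record { prefix = w≺x ; n = suc (suc k) ; lower = lower ; upper = upper } =
      subst Closed (sym w≺x) (closed-prefix k (length w)
        (subst (_< length w) (∣u∣+∣t∣ k) lower)
        (subst (length w ≤_) (∣u∣ (suc (suc k))) upper))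

    type-2-open : ∀ w → Type-2 x u w → Open w
    type-2-open w record { n = zero ; index = () , _ }
    -- As `t 1` is empty, no length meets both bounds.
    type-2-open w record { n = suc zero ; lower = lower ; upper = upper } =
      ⊥-elim (<⇒≱ lower (≤-trans upper (≤-reflexive (+-identityʳ _))))
    type-2-open w record { prefix = w≺x ; n = suc (suc k) ; lower = lower ; upper = upper } =
      subst Open (sym w≺x) (open-prefix k (length w)
        (subst (_< length w) (∣u∣ (suc k)) lower)
        (subst (length w ≤_) (∣u∣+∣t∣ k) upper))

theorem49 : (m : ℕ) (2≤m : 2 ≤ m) → let open Bonacci m 2≤m in
    (hω : InfiniteWord) → Is-hω hω →
    (u : ℕ → Word) → IsPalindromicPrefixSequence hω u →
    (∀ w → Type-1 hω u w → Closed w) × (∀ w → Type-2 hω u w → Open w)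
theorem49 m 2≤m hω ishω u isu = type-1-closed u isu , type-2-open u isu
  where open FixedPoint m 2≤m hω ishω
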